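{- Let $n\ge4$ be even. Let the additive group $\Lambda=\mathbb R^n$ act on $\mathbb R^{E_n}$ by $\lambda\cdot y=(\lambda_i+\lambda_j+y_{\{i,j\}})_{\{i,j\}\in E_n}$ for $\lambda\in\Lambda$, $y\in\mathbb R^{E_n}$. Then every $\Lambda$-invariant subset of $\mathbb R^{E_n}$ is fiber-invariant for the linear map $f:\mathbb R^{E_n}\to\mathbb R^{\mathcal M_n}$, $f(y)=(y_M)_{M\in\mathcal M_n}$, where $y_M=\sum_{e\in M}y_e$.
   Context: $E_n$ is the set of edges of the complete graph on $[n]=\{1,\dots,n\}$ and $\mathcal M_n$ is the set of its perfect matchings. For a map $f:X\to Y$, $D\subseteq X$ is fiber-invariant for $f$ if for each $y\in f(D)$ the fiber $f^{ -1}(y)$ is contained in $D$. -}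

module Defs where

open import Algebra.Bundles using (Group; AbelianGroup)
open import Algebra.Properties.CommutativeSemigroup using (interchange)
open import Algebra.Properties.Group using (⁻¹-involutive)
import Algebra.Construct.Pointwise as Pointwise
open import Data.Fin.Base using (Fin) renaming (_<_ to _<ᶠ_)
open import Data.List.Base using (List; []; _∷_; foldr; map)
open import Data.List.Membership.Propositional using () renaming (_∈_ to _∈ˡ_)
open import Data.List.Relation.Unary.Unique.Propositional using (Unique)
open import Data.Nat.Base as ℕ using (ℕ)
import Data.Nat.Properties as ℕ
open import Data.Product.Base using (∃; ∃-syntax; _×_; _,_)
open import Data.Product using (∃!)
open import Data.Rational.Base using (ℚ; 0ℚ; ½; ∣_∣; _<_; _+_; _-_; -_; _*_; positive)
import Data.Rational.Properties as ℚ
open import Data.Sum.Base using (_⊎_)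
open import Function.Bundles using (Func)
open import Level using (Level; _⊔_; 0ℓ)
open import Relation.Binary.Bundles using (Setoid)
open import Relation.Binary.PropositionalEquality using (_≡_; refl; sym; trans; cong; subst)
open import Relation.Unary using (Pred; _∈_; _⊆_)

private
  variable
    a b ℓ ℓ₁ ℓ₂ : Level

-- Real numbers: Cauchy sequences of rationals,
-- two sequences being equal when their difference tends to zero.

Cauchy : (ℕ → ℚ) → Set
Cauchy x = ∀ ε → 0ℚ < ε →
  ∃[ N ] (∀ m n → N ℕ.≤ m → N ℕ.≤ n → ∣ x m - x n ∣ < ε)

record ℝ : Set where
  no-eta-equality
  constructor mkℝ
  field
    seq    : ℕ → ℚ
    cauchy : Cauchy seq

open ℝ public

infix 4 _≈ᴿ_

record _≈ᴿ_ (x y : ℝ) : Set where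
  constructor mk≈ᴿ
  field
    tends-to-0 : ∀ ε → 0ℚ < ε → ∃[ N ] (∀ n → N ℕ.≤ n → ∣ seq x n - seq y n ∣ < ε)

open _≈ᴿ_ public

private
  half>0 : ∀ {ε} → 0ℚ < ε → 0ℚ < ½ * ε
  half>0 {ε} ε>0 = ℚ.positive⁻¹ (½ * ε) {{ℚ.pos*pos⇒pos ½ ε {{positive ε>0}}}}

  half+half : ∀ ε → ½ * ε + ½ * ε ≡ ε
  half+half ε = trans (sym (ℚ.*-distribʳ-+ ε ½ ½)) (ℚ.*-identityˡ ε)

  <-from-halves : ∀ {ε} p q → ∣ p ∣ < ½ * ε → ∣ q ∣ < ½ * ε → ∣ p + q ∣ < ε
  <-from-halves {ε} p q p< q< = subst (∣ p + q ∣ <_) (half+half ε)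
    (ℚ.≤-<-trans (ℚ.∣p+q∣≤∣p∣+∣q∣ p q) (ℚ.+-mono-< p< q<))

  ∣p-p∣≡0 : ∀ p → ∣ p - p ∣ ≡ 0ℚ
  ∣p-p∣≡0 p = cong ∣_∣ (ℚ.+-inverseʳ p)

  ∣p-q∣≡∣q-p∣ : ∀ p q → ∣ p - q ∣ ≡ ∣ q - p ∣
  ∣p-q∣≡∣q-p∣ p q = trans (sym (ℚ.∣-p∣≡∣p∣ (p - q)))
    (cong ∣_∣ (trans (ℚ.neg-distrib-+ p (- q))
      (trans (ℚ.+-comm (- p) (- - q)) (cong (_- p) (⁻¹-involutive (AbelianGroup.group ℚ.+-0-abelianGroup) q)))))

  telescope : ∀ p q r → (p - q) + (q - r) ≡ p - r
  telescope p q r = trans (ℚ.+-assoc p (- q) (q - r)) (cong (p +_)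
    (trans (sym (ℚ.+-assoc (- q) q (- r)))
      (trans (cong (_- r) (ℚ.+-inverseˡ q)) (ℚ.+-identityˡ (- r)))))

  sum-of-differences : ∀ p q r s → (p - r) + (q - s) ≡ (p + q) - (r + s)
  sum-of-differences p q r s = trans
    (interchange (AbelianGroup.commutativeSemigroup ℚ.+-0-abelianGroup) p (- r) q (- s))
    (cong (p + q +_) (sym (ℚ.neg-distrib-+ r s)))

  neg-difference : ∀ p q → ∣ - p - - q ∣ ≡ ∣ p - q ∣
  neg-difference p q = trans (cong ∣_∣ (sym (ℚ.neg-distrib-+ p (- q)))) (ℚ.∣-p∣≡∣p∣ (p - q))

  pointwise⇒≈ : ∀ {x y} → (∀ n → seq x n ≡ seq y n) → x ≈ᴿ y
  pointwise⇒≈ {x} {y} eq .tends-to-0 ε ε>0 = 0 , λ n _ →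
    subst (_< ε) (sym (trans (cong (λ p → ∣ p - seq y n ∣) (eq n)) (∣p-p∣≡0 (seq y n)))) ε>0

infixl 6 _+ᴿ_
infix  8 -ᴿ_

0ᴿ : ℝ
0ᴿ .seq _ = 0ℚ
0ᴿ .cauchy ε ε>0 = 0 , λ _ _ _ _ → ε>0

_+ᴿ_ : ℝ → ℝ → ℝ
(x +ᴿ y) .seq n = seq x n + seq y n
(x +ᴿ y) .cauchy ε ε>0 =
  let M , hM = cauchy x (½ * ε) (half>0 ε>0)
      N , hN = cauchy y (½ * ε) (half>0 ε>0)
  in M ℕ.⊔ N , λ m n m≥ n≥ →
     subst (λ p → ∣ p ∣ < ε) (sum-of-differences (seq x m) (seq y m) (seq x n) (seq y n))
       (<-from-halves (seq x m - seq x n) (seq y m - seq y n)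
         (hM m n (ℕ.m⊔n≤o⇒m≤o M N m≥) (ℕ.m⊔n≤o⇒m≤o M N n≥))
         (hN m n (ℕ.m⊔n≤o⇒n≤o M N m≥) (ℕ.m⊔n≤o⇒n≤o M N n≥)))

-ᴿ_ : ℝ → ℝ
(-ᴿ x) .seq n = - seq x n
(-ᴿ x) .cauchy ε ε>0 =
  let N , hN = cauchy x ε ε>0
  in N , λ m n m≥ n≥ → subst (_< ε) (sym (neg-difference (seq x m) (seq x n))) (hN m n m≥ n≥)

private
  ≈ᴿ-sym : ∀ {x y} → x ≈ᴿ y → y ≈ᴿ x
  ≈ᴿ-sym {x} {y} x≈y .tends-to-0 ε ε>0 =
    let N , hN = tends-to-0 x≈y ε ε>0
    in N , λ n n≥ → subst (_< ε) (∣p-q∣≡∣q-p∣ (seq x n) (seq y n)) (hN n n≥)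

  ≈ᴿ-trans : ∀ {x y z} → x ≈ᴿ y → y ≈ᴿ z → x ≈ᴿ z
  ≈ᴿ-trans {x} {y} {z} x≈y y≈z .tends-to-0 ε ε>0 =
    let M , hM = tends-to-0 x≈y (½ * ε) (half>0 ε>0)
        N , hN = tends-to-0 y≈z (½ * ε) (half>0 ε>0)
    in M ℕ.⊔ N , λ n n≥ →
       subst (λ p → ∣ p ∣ < ε) (telescope (seq x n) (seq y n) (seq z n))
         (<-from-halves (seq x n - seq y n) (seq y n - seq z n)
           (hM n (ℕ.m⊔n≤o⇒m≤o M N n≥)) (hN n (ℕ.m⊔n≤o⇒n≤o M N n≥)))

  +ᴿ-cong : ∀ {x x′ y y′} → x ≈ᴿ x′ → y ≈ᴿ y′ → (x +ᴿ y) ≈ᴿ (x′ +ᴿ y′)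
  +ᴿ-cong {x} {x′} {y} {y′} x≈ y≈ .tends-to-0 ε ε>0 =
    let M , hM = tends-to-0 x≈ (½ * ε) (half>0 ε>0)
        N , hN = tends-to-0 y≈ (½ * ε) (half>0 ε>0)
    in M ℕ.⊔ N , λ n n≥ →
       subst (λ p → ∣ p ∣ < ε) (sum-of-differences (seq x n) (seq y n) (seq x′ n) (seq y′ n))
         (<-from-halves (seq x n - seq x′ n) (seq y n - seq y′ n)
           (hM n (ℕ.m⊔n≤o⇒m≤o M N n≥)) (hN n (ℕ.m⊔n≤o⇒n≤o M N n≥)))

  -ᴿ-cong : ∀ {x y} → x ≈ᴿ y → (-ᴿ x) ≈ᴿ (-ᴿ y)
  -ᴿ-cong {x} {y} x≈y .tends-to-0 ε ε>0 =
    let N , hN = tends-to-0 x≈y ε ε>0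
    in N , λ n n≥ → subst (_< ε) (sym (neg-difference (seq x n) (seq y n))) (hN n n≥)

ℝ-abelianGroup : AbelianGroup 0ℓ 0ℓ
ℝ-abelianGroup = record
  { Carrier = ℝ
  ; _≈_     = _≈ᴿ_
  ; _∙_     = _+ᴿ_
  ; ε       = 0ᴿ
  ; _⁻¹     = -ᴿ_
  ; isAbelianGroup = record
    { isGroup = record
      { isMonoid = record
        { isSemigroup = record
          { isMagma = record
            { isEquivalence = record
              { refl  = pointwise⇒≈ (λ _ → refl)
              ; sym   = ≈ᴿ-sym
              ; trans = ≈ᴿ-trans
              }
            ; ∙-cong = +ᴿ-cong
            }
          ; assoc = λ x y z → pointwise⇒≈
              (λ n → ℚ.+-assoc (seq x n) (seq y n) (seq z n))
          }
        ; identity = (λ x → pointwise⇒≈ (λ n → ℚ.+-identityˡ (seq x n)))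
                   , (λ x → pointwise⇒≈ (λ n → ℚ.+-identityʳ (seq x n)))
        }
      ; inverse = (λ x → pointwise⇒≈ (λ n → ℚ.+-inverseˡ (seq x n)))
                , (λ x → pointwise⇒≈ (λ n → ℚ.+-inverseʳ (seq x n)))
      ; ⁻¹-cong = -ᴿ-cong
      }
    ; comm = λ x y → pointwise⇒≈ (λ n → ℚ.+-comm (seq x n) (seq y n))
    }
  }

module ℝ+ = AbelianGroup ℝ-abelianGroup

infix 9 ℝ^_

ℝ^_ : Set → AbelianGroup 0ℓ 0ℓ
ℝ^ I = Pointwise.abelianGroup I ℝ-abelianGroup

ℝ^-setoid : Set → Setoid 0ℓ 0ℓ
ℝ^-setoid I = AbelianGroup.setoid (ℝ^ I)

record Action (G : Group a ℓ₁) (X : Setoid b ℓ₂) : Set (a ⊔ b ⊔ ℓ₁ ⊔ ℓ₂) where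
  private
    module G = Group G
    module X = Setoid X
  infixr 7 _·_
  field
    _·_        : G.Carrier → X.Carrier → X.Carrier
    ·-cong     : ∀ {g h x y} → g G.≈ h → x X.≈ y → (g · x) X.≈ (h · y)
    ·-identity : ∀ x → (G.ε · x) X.≈ x
    ·-compose  : ∀ g h x → ((g G.∙ h) · x) X.≈ (g · (h · x))

Invariant : {G : Group a ℓ₁} {X : Setoid b ℓ₂} →
            Action G X → Pred (Setoid.Carrier X) ℓ → Set (a ⊔ b ⊔ ℓ)
Invariant A D = ∀ g {x} → x ∈ D → (g · x) ∈ D
  where open Action A

module _ {X : Setoid a ℓ₁} {Y : Setoid b ℓ₂} (f : Func X Y) where
  private
    module X = Setoid X
    module Y = Setoid Y
  open Func f using (to)

  Image : Pred X.Carrier ℓ → Pred Y.Carrier (a ⊔ ℓ₂ ⊔ ℓ)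
  Image D y = ∃ λ x → x ∈ D × to x Y.≈ y

  Fiber : Y.Carrier → Pred X.Carrier ℓ₂
  Fiber y x = to x Y.≈ y

  FiberInvariant : Pred X.Carrier ℓ → Set (a ⊔ b ⊔ ℓ₂ ⊔ ℓ)
  FiberInvariant D = ∀ {y} → y ∈ Image D → Fiber y ⊆ D

-- The unordered pair {i , j} is stored with its smaller endpoint first.
record Edge (n : ℕ) : Set where
  constructor edge
  field
    fst : Fin n
    snd : Fin n
    .fst<snd : fst <ᶠ snd

infix 4 _∈ᵉ_

_∈ᵉ_ : ∀ {n} → Fin n → Edge n → Set
v ∈ᵉ e = v ≡ Edge.fst e ⊎ v ≡ Edge.snd e

-- A set of edges is a duplicate-free list. Lists that differ only in order
-- are the same matching; since _+ᴿ_ is commutative they give the same y_M.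
record PerfectMatching (n : ℕ) : Set where
  field
    edges   : List (Edge n)
    unique  : Unique edges
    perfect : ∀ v → ∃! _≡_ λ e → e ∈ˡ edges × v ∈ᵉ e

Λ : ℕ → AbelianGroup 0ℓ 0ℓ
Λ n = ℝ^ (Fin n)

Λ-action : ∀ n → Action (AbelianGroup.group (Λ n)) (ℝ^-setoid (Edge n))
Λ-action n = record
  { _·_        = λ l y e → l (Edge.fst e) +ᴿ l (Edge.snd e) +ᴿ y e
  ; ·-cong     = λ l≈m x≈y e → ℝ+.∙-cong (ℝ+.∙-cong (l≈m _) (l≈m _)) (x≈y e)
  ; ·-identity = λ y e → ℝ+.trans (ℝ+.∙-congʳ (ℝ+.identityˡ 0ᴿ)) (ℝ+.identityˡ (y e))
  ; ·-compose  = λ l m y e → let i = Edge.fst e ; j = Edge.snd e in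
      ℝ+.trans
        (ℝ+.∙-congʳ (interchange ℝ+.commutativeSemigroup (l i) (m i) (l j) (m j)))
        (ℝ+.assoc (l i +ᴿ l j) (m i +ᴿ m j) (y e))
  }

sumᴿ : List ℝ → ℝ
sumᴿ = foldr _+ᴿ_ 0ᴿ

matchingSum : ∀ {n} → (Edge n → ℝ) → PerfectMatching n → ℝ
matchingSum y M = sumᴿ (map y (PerfectMatching.edges M))

private
  sum-cong : ∀ {n} {x y : Edge n → ℝ} → (∀ e → x e ≈ᴿ y e) →
             ∀ es → sumᴿ (map x es) ≈ᴿ sumᴿ (map y es)
  sum-cong x≈y []       = ℝ+.refl
  sum-cong x≈y (e ∷ es) = ℝ+.∙-cong (x≈y e) (sum-cong x≈y es)

matchingMap : ∀ n → Func (ℝ^-setoid (Edge n)) (ℝ^-setoid (PerfectMatching n))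
matchingMap n = record
  { to   = matchingSum
  ; cong = λ x≈y M → sum-cong x≈y (PerfectMatching.edges M)
  }

{-# OPTIONS --safe #-}
module Submission where

-- Two points of a fibre differ by some z whose sum over every perfect matching
-- vanishes. Swapping {a,b},{c,d} for {a,c},{b,d} inside a perfect matching gives
-- z_ab + z_cd = z_ac + z_bd. Hence d = z_0i + z_0j - z_ij does not depend on the
-- edge {i,j} avoiding 0, and l_0 = d/2, l_i = z_0i - d/2 satisfies
-- z_ij = l_i + l_j on all edges, so the two points lie in one Λ-orbit.

open import Defs
open import Data.Nat.Base using (ℕ; _≤_)
open import Data.Nat.Divisibility using (_∣_)
open import Level using (Level)
open import Relation.Binary.Bundles using (Setoid)
open import Relation.Binary.Definitions using (_Respects_)
open import Relation.Unary using (Pred)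

open import Algebra.Properties.Group ℝ+.group using (∙-cancelʳ)
open import Data.Empty using (⊥-elim-irr)
open import Data.Fin.Base using (Fin; zero; suc)
open import Data.Fin.Properties using (_≟_; <-cmp; <-asym; <⇒≢; 0≢1+n; suc-injective)
open import Data.List.Base using (List; []; _∷_; map; length; allFin)
open import Data.List.Membership.Propositional using (_∈_)
open import Data.List.Membership.Propositional.Properties using (∈-∃++; ∈-allFin)
open import Data.List.Properties using (length-tabulate)
open import Data.List.Relation.Binary.Permutation.Propositional
  using (_↭_; ↭-refl; ↭-trans; ↭⇒↭ₛ; prep; swap)
open import Data.List.Relation.Binary.Permutation.Propositional.Properties
  using (∈-resp-↭; ↭-length; shift)
import Data.List.Relation.Binary.Permutation.Setoid.Properties as Permutation
open import Data.List.Relation.Unary.All using (_∷_)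
import Data.List.Relation.Unary.All as All
open import Data.List.Relation.Unary.AllPairs using ([]; _∷_)
open import Data.List.Relation.Unary.Any using (here; there)
open import Data.List.Relation.Unary.Unique.Propositional using (Unique)
open import Data.List.Relation.Unary.Unique.Propositional.Properties using (allFin⁺)
open import Data.Nat.Base using (suc; s≤s; _*_)
open import Data.Nat.Divisibility using (divides)
open import Data.Nat.Properties using () renaming (suc-injective to ℕ-suc-injective)
open import Data.Product.Base using (∃-syntax; _×_; _,_)
open import Data.Rational.Base using (½; ∣_∣; _<_)
  renaming (_+_ to _+ℚ_; _*_ to _*ℚ_; _-_ to _-ℚ_)
import Data.Rational.Properties as ℚ
open import Data.Rational.Solver using (module +-*-Solver)
open import Data.Sum.Base using (_⊎_; inj₁; inj₂)
import Data.Sum.Base as Sum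
open import Function.Base using (_∘_)
open import Relation.Binary.Definitions using (tri<; tri≈; tri>)
open import Relation.Binary.PropositionalEquality
  using (_≡_; _≢_; refl; sym; trans; cong; subst; subst₂; ≢-sym)
open import Relation.Binary.PropositionalEquality.Properties using (setoid)
import Relation.Binary.Reasoning.Setoid as SetoidReasoning
open import Relation.Nullary.Decidable using (yes; no)
open import Relation.Nullary.Negation using (¬_; contradiction)

open +-*-Solver using (solve; con; _:+_; _:*_; _:-_; _:=_)

-- Halving and linear identities over the reals.

≗⇒≈ᴿ : ∀ {x y} → (∀ n → seq x n ≡ seq y n) → x ≈ᴿ y
≗⇒≈ᴿ {x} {y} x≗y .tends-to-0 ε ε>0 = 0 , λ n _ →
  subst (_< ε) (sym (cong ∣_∣ (trans (cong (_-ℚ seq y n) (x≗y n)) (ℚ.+-inverseʳ (seq y n))))) ε>0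

half : ℝ → ℝ
half x .seq n = ½ *ℚ seq x n
half x .cauchy ε ε>0 =
  -- Halving halves distances, so a tolerance of twice `ε` for `x` suffices.
  let N , hN = cauchy x (ε +ℚ ε) (ℚ.+-mono-< ε>0 ε>0)
  in N , λ m n m≥ n≥ →
     subst₂ _<_
       (trans (sym (ℚ.∣p*q∣≡∣p∣*∣q∣ ½ (seq x m -ℚ seq x n)))
         (cong ∣_∣ (solve 2 (λ p q → con ½ :* (p :- q) := con ½ :* p :- con ½ :* q) refl (seq x m) (seq x n))))
       (solve 1 (λ e → con ½ :* (e :+ e) := e) refl ε)
       (ℚ.*-monoʳ-<-pos ½ (hN m n m≥ n≥))

infixl 6 _-ᴿ_

_-ᴿ_ : ℝ → ℝ → ℝ
x -ᴿ y = x +ᴿ -ᴿ y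

sum-map-difference : ∀ {A : Set} (x y : A → ℝ) es →
  sumᴿ (map (λ e → x e -ᴿ y e) es) ≈ᴿ sumᴿ (map x es) -ᴿ sumᴿ (map y es)
sum-map-difference x y [] = ≗⇒≈ᴿ λ _ → refl
sum-map-difference x y (e ∷ es) = ℝ+.trans
  (ℝ+.∙-congˡ (sum-map-difference x y es))
  (≗⇒≈ᴿ λ n → solve 4 (λ a b s t → (a :- b) :+ (s :- t) := (a :+ s) :- (b :+ t)) refl
    (seq (x e) n) (seq (y e) n) (seq (sumᴿ (map x es)) n) (seq (sumᴿ (map y es)) n))

-- Edges given by two vertices in either order.

mkEdge : ∀ {n} (u v : Fin n) → .(u ≢ v) → Edge n
-- `Edge` wants the smaller endpoint first, so the pair is sorted; the irrelevant `u≢v` keeps the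
-- edge independent of the proof supplied.
mkEdge u v u≢v with <-cmp u v
... | tri< u<v _ _ = edge u v u<v
... | tri≈ _ u≡v _ = ⊥-elim-irr (u≢v u≡v)
... | tri> _ _ v<u = edge v u v<u

mkEdge-< : ∀ {n} (u v : Fin n) .(u≢v : u ≢ v) .u<v → mkEdge u v u≢v ≡ edge u v u<v
mkEdge-< u v u≢v u<v with <-cmp u v
... | tri< _ _ _   = refl
... | tri≈ _ u≡v _ = ⊥-elim-irr (u≢v u≡v)
... | tri> _ _ v<u = ⊥-elim-irr (<-asym u<v v<u)

mkEdge-> : ∀ {n} (u v : Fin n) .(u≢v : u ≢ v) .v<u → mkEdge u v u≢v ≡ edge v u v<u
mkEdge-> u v u≢v v<u with <-cmp u v
... | tri< u<v _ _ = ⊥-elim-irr (<-asym u<v v<u)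
... | tri≈ _ u≡v _ = ⊥-elim-irr (u≢v u≡v)
... | tri> _ _ _   = refl

mkEdge-comm : ∀ {n} (u v : Fin n) .(u≢v : u ≢ v) .(v≢u : v ≢ u) → mkEdge u v u≢v ≡ mkEdge v u v≢u
mkEdge-comm u v u≢v v≢u with <-cmp u v
... | tri< u<v _ _ = sym (mkEdge-> v u v≢u u<v)
... | tri≈ _ u≡v _ = ⊥-elim-irr (u≢v u≡v)
... | tri> _ _ v<u = sym (mkEdge-< v u v≢u v<u)

∈ᵉ-mkEdge⁺ : ∀ {n} {u v w : Fin n} .(u≢v : u ≢ v) → w ≡ u ⊎ w ≡ v → w ∈ᵉ mkEdge u v u≢v
∈ᵉ-mkEdge⁺ {u = u} {v} u≢v w∈ with <-cmp u v
... | tri< _ _ _   = w∈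
... | tri≈ _ u≡v _ = ⊥-elim-irr (u≢v u≡v)
... | tri> _ _ _   = Sum.swap w∈

∈ᵉ-mkEdge⁻ : ∀ {n} {u v w : Fin n} .(u≢v : u ≢ v) → w ∈ᵉ mkEdge u v u≢v → w ≡ u ⊎ w ≡ v
∈ᵉ-mkEdge⁻ {u = u} {v} u≢v w∈ with <-cmp u v
... | tri< _ _ _   = w∈
... | tri≈ _ u≡v _ = ⊥-elim-irr (u≢v u≡v)
... | tri> _ _ _   = Sum.swap w∈

-- Perfect matchings read off from vertex orderings.

pairUp : ∀ {n} (vs : List (Fin n)) → Unique vs → List (Edge n)
pairUp []           _                         = []
-- An odd leftover vertex is dropped, hence the even length in `pairUp-covers`.
pairUp (_ ∷ [])     _                         = []
pairUp (u ∷ v ∷ vs) ((u≢v ∷ _) ∷ _ ∷ vs-uniq) = mkEdge u v u≢v ∷ pairUp vs vs-uniq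

-- Two orderings with a common tail bring different uniqueness proofs for it, yet the tail sums must
-- cancel. They do because `mkEdge` ignores its proof.
pairUp-irrelevant : ∀ {n} (vs : List (Fin n)) (p q : Unique vs) → pairUp vs p ≡ pairUp vs q
pairUp-irrelevant []           _ _ = refl
pairUp-irrelevant (_ ∷ [])     _ _ = refl
pairUp-irrelevant (u ∷ v ∷ vs) ((u≢v ∷ _) ∷ _ ∷ p) ((_ ∷ _) ∷ _ ∷ q) =
  cong (mkEdge u v u≢v ∷_) (pairUp-irrelevant vs p q)

pairUp-∷∷ : ∀ {n} {u v : Fin n} {vs} (p : Unique (u ∷ v ∷ vs)) .(u≢v : u ≢ v) (q : Unique vs) →
  pairUp (u ∷ v ∷ vs) p ≡ mkEdge u v u≢v ∷ pairUp vs q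
pairUp-∷∷ {vs = vs} ((_ ∷ _) ∷ _ ∷ p) u≢v q = cong (_ ∷_) (pairUp-irrelevant vs p q)

pairUp-endpoint : ∀ {n} {e : Edge n} {w} vs p → e ∈ pairUp vs p → w ∈ᵉ e → w ∈ vs
pairUp-endpoint (u ∷ v ∷ vs) ((u≢v ∷ _) ∷ _ ∷ p) (here refl) w∈e with ∈ᵉ-mkEdge⁻ u≢v w∈e
... | inj₁ w≡u = here w≡u
... | inj₂ w≡v = there (here w≡v)
pairUp-endpoint (u ∷ v ∷ vs) ((_ ∷ _) ∷ _ ∷ p) (there e∈) w∈e =
  there (there (pairUp-endpoint vs p e∈ w∈e))

pairUp-covers : ∀ {n} {w : Fin n} k vs p → length vs ≡ k * 2 → w ∈ vs →
  ∃[ e ] (e ∈ pairUp vs p × w ∈ᵉ e)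
pairUp-covers (suc k) (u ∷ v ∷ vs) ((u≢v ∷ _) ∷ _ ∷ _) _ (here w≡u) =
  _ , here refl , ∈ᵉ-mkEdge⁺ u≢v (inj₁ w≡u)
pairUp-covers (suc k) (u ∷ v ∷ vs) ((u≢v ∷ _) ∷ _ ∷ _) _ (there (here w≡v)) =
  _ , here refl , ∈ᵉ-mkEdge⁺ u≢v (inj₂ w≡v)
pairUp-covers (suc k) (u ∷ v ∷ vs) ((_ ∷ _) ∷ _ ∷ p) len (there (there w∈)) =
  let e , e∈ , w∈e = pairUp-covers k vs p (ℕ-suc-injective (ℕ-suc-injective len)) w∈
  in e , there e∈ , w∈e

-- Source of both `pairUp-disjoint` and `pairUp-unique`: entries of the first pair do not recur
-- later.
head-pair-avoids-tail : ∀ {n} {u v w : Fin n} {vs} → Unique (u ∷ v ∷ vs) →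
  .(u≢v : u ≢ v) → w ∈ᵉ mkEdge u v u≢v → ¬ w ∈ vs
head-pair-avoids-tail ((_ ∷ u∉) ∷ v∉ ∷ _) u≢v w∈e w∈vs with ∈ᵉ-mkEdge⁻ u≢v w∈e
... | inj₁ refl = All.lookup u∉ w∈vs refl
... | inj₂ refl = All.lookup v∉ w∈vs refl

pairUp-disjoint : ∀ {n} {w : Fin n} {e f} vs p → e ∈ pairUp vs p → w ∈ᵉ e →
  f ∈ pairUp vs p → w ∈ᵉ f → e ≡ f
pairUp-disjoint (_ ∷ _ ∷ _) ((_ ∷ _) ∷ _ ∷ _) (here refl) _ (here refl) _ = refl
pairUp-disjoint (_ ∷ _ ∷ vs) u@((u≢v ∷ _) ∷ _ ∷ p) (here refl) w∈e (there f∈) w∈f =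
  contradiction (pairUp-endpoint vs p f∈ w∈f) (head-pair-avoids-tail u u≢v w∈e)
pairUp-disjoint (_ ∷ _ ∷ vs) u@((u≢v ∷ _) ∷ _ ∷ p) (there e∈) w∈e (here refl) w∈f =
  contradiction (pairUp-endpoint vs p e∈ w∈e) (head-pair-avoids-tail u u≢v w∈f)
pairUp-disjoint (_ ∷ _ ∷ vs) ((_ ∷ _) ∷ _ ∷ p) (there e∈) w∈e (there f∈) w∈f =
  pairUp-disjoint vs p e∈ w∈e f∈ w∈f

pairUp-unique : ∀ {n} (vs : List (Fin n)) p → Unique (pairUp vs p)
pairUp-unique []           _ = []
pairUp-unique (_ ∷ [])     _ = []
pairUp-unique (u ∷ v ∷ vs) q@((u≢v ∷ _) ∷ _ ∷ p) =
  -- The head edge contains `u`, so an equal later edge would put `u` into the tail.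
  All.tabulate (λ f∈ e≡f → head-pair-avoids-tail q u≢v u∈e
    (pairUp-endpoint vs p f∈ (subst (u ∈ᵉ_) e≡f u∈e)))
  ∷ pairUp-unique vs p
  where u∈e = ∈ᵉ-mkEdge⁺ {w = u} u≢v (inj₁ refl)

ordering-unique : ∀ {n} {vs : List (Fin n)} → allFin n ↭ vs → Unique vs
ordering-unique {n} σ = Permutation.Unique-resp-↭ (setoid (Fin n)) (↭⇒↭ₛ σ) (allFin⁺ n)

-- Permuting an ordering gives an ordering, so an edge set obtained by exchange is a perfect
-- matching without a separate check.
matching : ∀ {n} → 2 ∣ n → (vs : List (Fin n)) → allFin n ↭ vs → PerfectMatching n
matching {n} (divides k n≡k*2) vs σ = record
  { edges   = pairUp vs p
  ; unique  = pairUp-unique vs p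
  ; perfect = λ v →
      let e , e∈ , v∈e = pairUp-covers k vs p len (∈-resp-↭ σ (∈-allFin v))
      in e , (e∈ , v∈e) , λ (f∈ , v∈f) → pairUp-disjoint vs p e∈ v∈e f∈ v∈f
  }
  where
  p = ordering-unique σ
  len = trans (sym (↭-length σ)) (trans (length-tabulate {n = n} (λ v → v)) n≡k*2)

∈⇒↭∷ : ∀ {A : Set} {x : A} {xs} → x ∈ xs → ∃[ ys ] (xs ↭ x ∷ ys)
∈⇒↭∷ {x = x} x∈xs with ∈-∃++ x∈xs
... | ys , zs , refl = _ , shift x ys zs

∈-tail : ∀ {A : Set} {x y : A} {xs} → x ≢ y → x ∈ y ∷ xs → x ∈ xs
∈-tail x≢y (here x≡y) = contradiction x≡y x≢y
∈-tail x≢y (there x∈) = x∈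

-- Vertices are pulled to the front one at a time; those still to come stay in the remainder because
-- they differ from the ones removed.
ordering-from : ∀ {n} {a b c d : Fin n} → a ≢ b → a ≢ c → a ≢ d → b ≢ c → b ≢ d → c ≢ d →
  ∃[ rest ] (allFin n ↭ a ∷ b ∷ c ∷ d ∷ rest)
ordering-from {n} {a} {b} {c} {d} a≢b a≢c a≢d b≢c b≢d c≢d =
  let r₁ , σ₁ = ∈⇒↭∷ (∈-allFin a)
      among-r₁ : ∀ {v} → a ≢ v → v ∈ r₁
      among-r₁ a≢v = ∈-tail (≢-sym a≢v) (∈-resp-↭ σ₁ (∈-allFin _))
      r₂ , σ₂ = ∈⇒↭∷ (among-r₁ a≢b)
      among-r₂ : ∀ {v} → a ≢ v → b ≢ v → v ∈ r₂
      among-r₂ a≢v b≢v = ∈-tail (≢-sym b≢v) (∈-resp-↭ σ₂ (among-r₁ a≢v))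
      r₃ , σ₃ = ∈⇒↭∷ (among-r₂ a≢c b≢c)
      r₄ , σ₄ = ∈⇒↭∷ (∈-tail (≢-sym c≢d) (∈-resp-↭ σ₃ (among-r₂ a≢d b≢d)))
  in r₄ , ↭-trans σ₁ (prep a (↭-trans σ₂ (prep b (↭-trans σ₃ (prep c σ₄)))))

-- The exchange relation for vectors in the kernel.

module _ {n} (2∣n : 2 ∣ n) (z : Edge n → ℝ) (z-kernel : ∀ M → matchingSum z M ≈ᴿ 0ᴿ) where

  -- `p` is free rather than inherited from `σ`, so that two orderings ending in `rest` yield
  -- literally the same tail sum.
  ordering-sum≈0 : ∀ {a b c d rest} → allFin n ↭ a ∷ b ∷ c ∷ d ∷ rest →
    .(a≢b : a ≢ b) .(c≢d : c ≢ d) (p : Unique rest) →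
    z (mkEdge a b a≢b) +ᴿ (z (mkEdge c d c≢d) +ᴿ sumᴿ (map z (pairUp rest p))) ≈ᴿ 0ᴿ
  ordering-sum≈0 {rest = rest} σ a≢b c≢d p with ordering-unique σ in eq
  ... | q@(_ ∷ _ ∷ q′) = subst (λ es → sumᴿ (map z es) ≈ᴿ 0ᴿ)
    (trans (cong (pairUp _) eq)
      (trans (pairUp-∷∷ q a≢b q′) (cong (_ ∷_) (pairUp-∷∷ q′ c≢d p))))
    (z-kernel (matching 2∣n _ σ))

  -- The orderings `a, b, c, d, rest` and `a, c, b, d, rest` give matchings that agree on `rest`;
  -- both sums vanish and the common part cancels.
  exchange : ∀ {a b c d} (a≢b : a ≢ b) (a≢c : a ≢ c) (a≢d : a ≢ d) (b≢c : b ≢ c) (b≢d : b ≢ d) (c≢d : c ≢ d) →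
    z (mkEdge a b a≢b) +ᴿ z (mkEdge c d c≢d) ≈ᴿ z (mkEdge a c a≢c) +ᴿ z (mkEdge b d b≢d)
  exchange {a} {b} {c} {d} a≢b a≢c a≢d b≢c b≢d c≢d
    with rest , σ ← ordering-from a≢b a≢c a≢d b≢c b≢d c≢d
    with _ ∷ _ ∷ _ ∷ _ ∷ p ← ordering-unique σ =
    ∙-cancelʳ (sumᴿ (map z (pairUp rest p))) _ _
      (ℝ+.trans (ℝ+.assoc _ _ _)
        (ℝ+.trans (ordering-sum≈0 σ a≢b c≢d p)
          (ℝ+.sym (ℝ+.trans (ℝ+.assoc _ _ _)
            (ordering-sum≈0 (↭-trans σ (prep a (swap b c ↭-refl))) a≢c b≢d p)))))

-- Solving for the vertex potential, with vertex `zero` as hub.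

module Decomposition {m} (2∣n : 2 ∣ suc m) (z : Edge (suc m) → ℝ)
  (z-kernel : ∀ M → matchingSum z M ≈ᴿ 0ᴿ) where

  spoke : Fin m → ℝ
  spoke i = z (mkEdge zero (suc i) 0≢1+n)

  rim : (i j : Fin m) → .(i ≢ j) → ℝ
  rim i j i≢j = z (mkEdge (suc i) (suc j) (λ si≡sj → i≢j (suc-injective si≡sj)))

  -- If z {u , v} = l u + l v for all edges, the defect equals 2 l₀.
  defect : (i j : Fin m) → .(i ≢ j) → ℝ
  defect i j i≢j = spoke i +ᴿ spoke j -ᴿ rim i j i≢j

  defect-comm : ∀ i j .(i≢j : i ≢ j) .(j≢i : j ≢ i) → defect i j i≢j ≈ᴿ defect j i j≢i
  defect-comm i j i≢j j≢i = ℝ+.∙-cong (ℝ+.comm (spoke i) (spoke j))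
    (ℝ+.reflexive (cong (λ e → -ᴿ z e) (mkEdge-comm (suc i) (suc j) _ _)))

  -- Exchange at the hub gives `spoke i + rim j k = spoke j + rim i k`; add `spoke k` and move the
  -- rims across. It needs four distinct vertices, so `i = j` is split off.
  defect-slide : ∀ i j k (i≢k : i ≢ k) (j≢k : j ≢ k) → defect i k i≢k ≈ᴿ defect j k j≢k
  defect-slide i j k i≢k j≢k with i ≟ j
  ... | yes refl = ℝ+.refl
  ... | no i≢j = begin
    defect i k i≢k
      ≈⟨ ≗⇒≈ᴿ (λ t → regroup (seq (spoke i) t) (seq (spoke k) t) (seq (rim i k i≢k) t) (seq (rim j k j≢k) t)) ⟩
    (spoke i +ᴿ rim j k j≢k) +ᴿ (spoke k -ᴿ (rim i k i≢k +ᴿ rim j k j≢k))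
      ≈⟨ ℝ+.∙-cong (exchange 2∣n z z-kernel 0≢1+n 0≢1+n 0≢1+n (i≢j ∘ suc-injective) (i≢k ∘ suc-injective) (j≢k ∘ suc-injective))
           (ℝ+.∙-congˡ {spoke k} (ℝ+.⁻¹-cong (ℝ+.comm (rim i k i≢k) (rim j k j≢k)))) ⟩
    (spoke j +ᴿ rim i k i≢k) +ᴿ (spoke k -ᴿ (rim j k j≢k +ᴿ rim i k i≢k))
      ≈⟨ ≗⇒≈ᴿ (λ t → regroup (seq (spoke j) t) (seq (spoke k) t) (seq (rim j k j≢k) t) (seq (rim i k i≢k) t)) ⟨
    defect j k j≢k ∎
    where
    open SetoidReasoning ℝ+.setoid
    regroup : ∀ a b c d → a +ℚ b -ℚ c ≡ (a +ℚ d) +ℚ (b -ℚ (c +ℚ d))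
    regroup = solve 4 (λ a b c d → a :+ b :- c := (a :+ d) :+ (b :- (c :+ d))) refl

  -- One endpoint moves at a time, from {i, j} via {a, j} to {a, b}. When `a = j` the middle pair
  -- degenerates, and `i` moves straight to `b`.
  defect-constant : ∀ i j a b (i≢j : i ≢ j) (a≢b : a ≢ b) → defect i j i≢j ≈ᴿ defect a b a≢b
  defect-constant i j a b i≢j a≢b with a ≟ j
  ... | yes refl = ℝ+.trans (defect-slide i b a i≢j (≢-sym a≢b)) (defect-comm b a (≢-sym a≢b) a≢b)
  ... | no a≢j = ℝ+.trans (defect-slide i a j i≢j a≢j)
    (ℝ+.trans (defect-comm a j a≢j (≢-sym a≢j))
      (ℝ+.trans (defect-slide j b a (≢-sym a≢j) (≢-sym a≢b)) (defect-comm b a (≢-sym a≢b) a≢b)))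

  module _ (a b : Fin m) (a≢b : a ≢ b) where

    potential : Fin (suc m) → ℝ
    potential zero    = half (defect a b a≢b)
    potential (suc i) = spoke i -ᴿ half (defect a b a≢b)

    -- At the hub the two halves cancel. Elsewhere they add up to one defect, which by
    -- `defect-constant` may be taken at the edge itself, leaving its `z`.
    potential-sum : ∀ e → potential (Edge.fst e) +ᴿ potential (Edge.snd e) ≈ᴿ z e
    potential-sum (edge zero (suc j) _) = ≗⇒≈ᴿ λ t →
      solve 2 (λ h s → h :+ (s :- h) := s) refl (seq (half (defect a b a≢b)) t) (seq (spoke j) t)
    potential-sum (edge (suc i) (suc j) si<sj) = begin
      (spoke i -ᴿ half d) +ᴿ (spoke j -ᴿ half d)
        ≈⟨ ≗⇒≈ᴿ (λ t → solve 3 (λ p q g → (p :- con ½ :* g) :+ (q :- con ½ :* g) := p :+ q :- g) refl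
             (seq (spoke i) t) (seq (spoke j) t) (seq d t)) ⟩
      spoke i +ᴿ spoke j -ᴿ d
        ≈⟨ ℝ+.∙-congˡ {spoke i +ᴿ spoke j} (ℝ+.⁻¹-cong (defect-constant a b i j a≢b i≢j)) ⟩
      spoke i +ᴿ spoke j -ᴿ defect i j i≢j
        ≈⟨ ≗⇒≈ᴿ (λ t → solve 3 (λ p q r → p :+ q :- (p :+ q :- r) := r) refl
             (seq (spoke i) t) (seq (spoke j) t) (seq (rim i j i≢j) t)) ⟩
      rim i j i≢j
        ≡⟨ cong z (mkEdge-< (suc i) (suc j) _ si<sj) ⟩
      z (edge (suc i) (suc j) si<sj) ∎
      where
      open SetoidReasoning ℝ+.setoid
      d = defect a b a≢b
      i≢j : i ≢ j
      -- The order proof stored in an edge is irrelevant, so it can only serve to refute `i≡j`.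
      i≢j i≡j = ⊥-elim-irr (<⇒≢ si<sj (cong suc i≡j))

theorem4p6 : ∀ {ℓ : Level} (n : ℕ) → 4 ≤ n → 2 ∣ n →
    (D : Pred (Edge n → ℝ) ℓ) → D Respects (Setoid._≈_ (ℝ^-setoid (Edge n))) →
    Invariant (Λ-action n) D → FiberInvariant (matchingMap n) D
theorem4p6 (suc (suc (suc m))) (s≤s (s≤s (s≤s _))) 2∣n D D-resp D-inv {y} (x , x∈D , fx≈y) {x′} fx′≈y =
  -- The orbit of `x` reaches `x′` only up to `≈ᴿ` in each coordinate, and `D-resp` bridges this.
  D-resp l·x≈x′ (D-inv l x∈D)
  where
  z : Edge _ → ℝ
  z e = x′ e -ᴿ x e

  z-kernel : ∀ M → matchingSum z M ≈ᴿ 0ᴿ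
  z-kernel M = ℝ+.trans (sum-map-difference x′ x (PerfectMatching.edges M))
    (ℝ+.trans (ℝ+.∙-cong (fx′≈y M) (ℝ+.⁻¹-cong (fx≈y M))) (ℝ+.inverseʳ (y M)))

  open Decomposition 2∣n z z-kernel

  l : Fin _ → ℝ
  -- The indices count non-hub vertices: the reference edge joins the second and third vertices,
  -- exposed by matching `n` as at least three.
  l = potential zero (suc zero) 0≢1+n

  l·x≈x′ : ∀ e → l (Edge.fst e) +ᴿ l (Edge.snd e) +ᴿ x e ≈ᴿ x′ e
  l·x≈x′ e = ℝ+.trans (ℝ+.∙-congʳ (potential-sum zero (suc zero) 0≢1+n e))
    (≗⇒≈ᴿ λ t → solve 2 (λ p q → (p :- q) :+ q := p) refl (seq (x′ e) t) (seq (x e) t))
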